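{- Let $N\ge 1$, $w\in\mathbb{R}^N$, $\mathcal{C}:=\{i: w_i\ne 0\}$, let $V:\mathbb{R}^N\to\mathbb{R}$ be a quadratic polynomial (the penalty), let $\mathcal{F}\subseteq\{0,1\}^{\mathcal{C}}$ be the set of feasible core assignments, and let $\mathcal{D}\subseteq\mathbb{R}^N$ be a bounded set of directions. Consider $$\hat f(z)=w^\top z+\gamma V(z),\qquad z\in[0,1]^N,$$ where $\gamma$ is a real penalty parameter, and assume: (i) (core binarity) every local minimizer of $\hat f$ over $[0,1]^N$ has a binary core; (ii) (local repairability) $V$ is locally repairable with margin $\delta>0$ relative to the bounded direction set $\mathcal{D}$. Define $$L:=\sup\{\langle w,d\rangle : z\in[0,1]^N \text{ has infeasible binary core},\ d\in\mathcal{D}\cap T(z)\}.$$ Then, for every $\gamma>L/\delta$, every local minimizer of $\hat f$ over $[0,1]^N$ has feasible core.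
   Context: The core of $z\in[0,1]^N$ is the restriction $z_{\mathcal{C}}=(z_i)_{i\in\mathcal{C}}$. The core is binary if $z_{\mathcal{C}}\in\{0,1\}^{\mathcal{C}}$, feasible if $z_{\mathcal{C}}\in\mathcal{F}$, and infeasible binary if $z_{\mathcal{C}}\in\{0,1\}^{\mathcal{C}}\setminus\mathcal{F}$. The tangent cone of the box at $z\in[0,1]^N$ is $T(z):=\{d\in\mathbb{R}^N : z_i=0\Rightarrow d_i\ge 0,\ z_i=1\Rightarrow d_i\le 0\}$ (coordinates with $0<z_i<1$ are unrestricted). $V$ is locally repairable with margin $\delta>0$ relative to $\mathcal{D}$ if for every $z\in[0,1]^N$ with infeasible binary core there exists $d\in\mathcal{D}\cap T(z)$ with $\langle\nabla V(z),d\rangle\le-\delta$. A local minimizer of $\hat f$ over $[0,1]^N$ is a point of $[0,1]^N$ minimizing $\hat f$ among all points of $[0,1]^N$ in some neighborhood of it.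
   Formalization: The penalty parameter γ is assumed nonnegative; for negative γ > L/δ the claim fails, e.g. N=1, w=1, V(z)=z²+z, F={0}, D={−2}, δ=1, γ=−1, where L=−2 and z=1 is the only local minimizer but is infeasible. -}

module Defs where

open import Algebra.Bundles using (CommutativeRing)
open import Axiom.ExcludedMiddle using (ExcludedMiddle)
open import Data.Fin.Base using (Fin)
open import Data.Nat.Base using (ℕ)
open import Data.Product.Base using (Σ; ∃; _×_; _,_; proj₁)
open import Data.Sum.Base using (_⊎_)
open import Data.Vec.Functional using (Vector; updateAt)
open import Level using (0ℓ; suc)
open import Relation.Binary.Core using (Rel)
open import Relation.Binary.Structures using (IsTotalOrder)
import Relation.Binary.Construct.Add.Extrema.NonStrict as NonStrictExtrema
import Relation.Binary.Construct.Add.Extrema.Strict as StrictExtrema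
import Relation.Binary.Construct.Add.Supremum.NonStrict as AddSupremum
import Relation.Binary.Construct.NonStrictToStrict as NonStrictToStrict
open import Relation.Nullary.Construct.Add.Extrema using (_±; ⊥±; ⊤±; [_])
open import Relation.Nullary.Decidable.Core using (yes; no)
open import Relation.Nullary.Negation using (¬_; contradiction)
open import Relation.Unary using (Pred; Satisfiable)

-- The library has no real numbers.  They are given axiomatically, as a
-- complete ordered field; such a field is unique up to isomorphism.
record RealField : Set (suc 0ℓ) where
  field
    commutativeRing : CommutativeRing 0ℓ 0ℓ
  open CommutativeRing commutativeRing public

  infix 4 _≤_
  infix 8 _⁻¹
  field
    _≤_          : Rel Carrier 0ℓ
    isTotalOrder : IsTotalOrder _≈_ _≤_
    +-monoˡ-≤    : ∀ {x y} z → x ≤ y → x + z ≤ y + z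
    *-nonneg     : ∀ {x y} → 0# ≤ x → 0# ≤ y → 0# ≤ x * y
    0≉1          : 0# ≉ 1#
    -- Nothing is assumed about 0# ⁻¹.
    _⁻¹          : Carrier → Carrier
    ⁻¹-inverseʳ  : ∀ {x} → x ≉ 0# → x * x ⁻¹ ≈ 1#

  UpperBound : Pred Carrier 0ℓ → Pred Carrier 0ℓ
  UpperBound S b = ∀ x → S x → x ≤ b

  field
    complete : (S : Pred Carrier 0ℓ) → Satisfiable S → Satisfiable (UpperBound S) →
               ∃ λ s → UpperBound S s × (∀ b → UpperBound S b → s ≤ b)

  open IsTotalOrder isTotalOrder public
    using ()
    renaming ( refl to ≤-refl; reflexive to ≤-reflexive; trans to ≤-trans
             ; antisym to ≤-antisym; total to ≤-total )

  open NonStrictToStrict _≈_ _≤_ public using (_<_)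
  open NonStrictExtrema _≤_ public using (_≤±_)
  open StrictExtrema _<_ public using (_<±_)

module Analysis (R : RealField) where

  open RealField R
  open import Algebra.Properties.Semiring.Sum semiring using (sum)

  private
    module E = NonStrictExtrema _≤_

  -- Suprema are taken in Carrier ±, the extended real line: the supremum of
  -- the empty set is ⊥±, that of a set unbounded above is ⊤±.

  IsSup : Pred Carrier 0ℓ → Pred (Carrier ±) 0ℓ
  IsSup S s = (∀ x → S x → [ x ] ≤± s) ×
              (∀ b → (∀ x → S x → [ x ] ≤± b) → s ≤± b)

  sup-exists : ExcludedMiddle 0ℓ → (S : Pred Carrier 0ℓ) → ∃ (IsSup S)
  sup-exists em S with em {Satisfiable S}
  ... | no S-empty =
    ⊥± , (λ x Sx → contradiction (x , Sx) S-empty) , (λ b _ → E.≤±-minimum b)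
  ... | yes (x₀ , Sx₀) with em {Satisfiable (UpperBound S)}
  ...   | yes bdd =
    let (s , s-ub , s-least) = complete S (x₀ , Sx₀) bdd in
    [ s ] , (λ x Sx → E.[ s-ub x Sx ]) , λ where
      ⊥±    ub → contradiction (ub x₀ Sx₀) λ { AddSupremum.[ () ] }
      [ b ] ub → E.[ s-least b (λ x Sx → E.[≤]-injective (ub x Sx)) ]
      ⊤±    ub → E.≤±-maximum [ s ]
  ...   | no unbdd =
    ⊤± , (λ x _ → E.≤±-maximum [ x ]) , λ where
      ⊥±    ub → contradiction (ub x₀ Sx₀) λ { AddSupremum.[ () ] }
      [ b ] ub → contradiction (b , λ x Sx → E.[≤]-injective (ub x Sx)) unbdd
      ⊤±    ub → E.≤±-maximum ⊤±

  sup : ExcludedMiddle 0ℓ → Pred Carrier 0ℓ → Carrier ±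
  sup em S = proj₁ (sup-exists em S)

  -- Only meaningful for a positive divisor, which fixes both infinities.
  infixl 7 _/±_
  _/±_ : Carrier ± → Carrier → Carrier ±
  ⊥±    /± δ = ⊥±
  [ x ] /± δ = [ x * δ ⁻¹ ]
  ⊤±    /± δ = ⊤±

  infix 4 ∣_∣<_
  ∣_∣<_ : Rel Carrier 0ℓ
  ∣ x ∣< ε = (- ε < x) × (x < ε)

  ℝ^_ : ℕ → Set
  ℝ^ N = Vector Carrier N

  module _ {N : ℕ} where

    ⟨_,_⟩ : ℝ^ N → ℝ^ N → Carrier
    ⟨ x , y ⟩ = sum λ i → x i * y i

    ‖_‖² : ℝ^ N → Carrier
    ‖ x ‖² = ⟨ x , x ⟩

    Bounded : Pred (ℝ^ N) 0ℓ → Set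
    Bounded D = ∃ λ M → 0# ≤ M × (∀ d → D d → ‖ d ‖² ≤ M * M)

    IsQuadraticPolynomial : (ℝ^ N → Carrier) → Set
    IsQuadraticPolynomial V =
      Σ (Fin N → Fin N → Carrier) λ Q → Σ (ℝ^ N) λ b → Σ Carrier λ c →
        ∀ z → V z ≈ (sum λ i → sum λ j → Q i j * (z i * z j)) + ⟨ b , z ⟩ + c

    IsPartialDerivative : (ℝ^ N → Carrier) → ℝ^ N → Fin N → Carrier → Set
    IsPartialDerivative V z i a =
      ∀ ε → 0# < ε → ∃ λ η → 0# < η ×
        (∀ t → t ≉ 0# → ∣ t ∣< η →
          ∣ (V (updateAt z i (_+ t)) - V z) * t ⁻¹ - a ∣< ε)

    IsGradient : (ℝ^ N → Carrier) → ℝ^ N → Pred (ℝ^ N) 0ℓ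
    IsGradient V z g = ∀ i → IsPartialDerivative V z i (g i)

    Box : Pred (ℝ^ N) 0ℓ
    Box z = ∀ i → 0# ≤ z i × z i ≤ 1#

    TangentCone : ℝ^ N → Pred (ℝ^ N) 0ℓ
    TangentCone z d = ∀ i → (z i ≈ 0# → 0# ≤ d i) × (z i ≈ 1# → d i ≤ 0#)

    IsLocalMinimizer : (ℝ^ N → Carrier) → Pred (ℝ^ N) 0ℓ
    IsLocalMinimizer f z =
      Box z × ∃ λ ε → 0# < ε ×
        (∀ y → Box y → ‖ (λ i → y i - z i) ‖² < ε * ε → f z ≤ f y)

    objective : ℝ^ N → (ℝ^ N → Carrier) → Carrier → ℝ^ N → Carrier
    objective w V γ z = ⟨ w , z ⟩ + γ * V z

    CoreIndex : ℝ^ N → Set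
    CoreIndex w = ∃ λ i → w i ≉ 0#

    CoreVector : ℝ^ N → Set
    CoreVector w = CoreIndex w → Carrier

    core : (w : ℝ^ N) → ℝ^ N → CoreVector w
    core w z (i , _) = z i

    Binary : (w : ℝ^ N) → Pred (CoreVector w) 0ℓ
    Binary w a = ∀ k → a k ≈ 0# ⊎ a k ≈ 1#

    InfeasibleBinary : (w : ℝ^ N) → Pred (CoreVector w) 0ℓ → Pred (CoreVector w) 0ℓ
    InfeasibleBinary w F a = Binary w a × ¬ F a

    LocallyRepairable : (w : ℝ^ N) → Pred (CoreVector w) 0ℓ →
                        (ℝ^ N → Carrier) → Pred (ℝ^ N) 0ℓ → Carrier → Set
    LocallyRepairable w F V D δ =
      ∀ z → Box z → InfeasibleBinary w F (core w z) →
        Σ (ℝ^ N) λ g → IsGradient V z g ×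
          Σ (ℝ^ N) λ d → D d × TangentCone z d × ⟨ g , d ⟩ ≤ - δ

    -- The set of values ⟨ w , d ⟩ whose supremum is the threshold L.
    LinearGains : (w : ℝ^ N) → Pred (CoreVector w) 0ℓ → Pred (ℝ^ N) 0ℓ → Pred Carrier 0ℓ
    LinearGains w F D x =
      Σ (ℝ^ N) λ z → Σ (ℝ^ N) λ d →
        Box z × InfeasibleBinary w F (core w z) ×
        D d × TangentCone z d × x ≈ ⟨ w , d ⟩

{-# OPTIONS --safe #-}

-- At an infeasible binary core, repairability supplies a tangent direction d
-- along which V decreases at rate at least δ, while the linear part increases
-- at rate at most L < γ δ.  So the objective has negative slope along d, and
-- for small t > 0 the point z + t d lies in the box, is arbitrarily close to z
-- and has a smaller value: z is not a local minimizer.  Since V is quadratic,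
-- t ↦ V (z + t d) is a polynomial of degree 2, and no limit is needed beyond
-- identifying the partial derivatives of V with the formal ones.
module Submission where

open import Defs
open import Axiom.ExcludedMiddle using (ExcludedMiddle)
open import Data.Fin.Base using (Fin; zero; suc)
open import Data.Nat.Base as ℕ using (ℕ)
open import Data.Product.Base using (∃; _×_; _,_; proj₁; proj₂)
open import Data.Sum.Base using (inj₁; inj₂)
open import Data.Vec.Functional using (updateAt)
open import Level using (0ℓ)
open import Relation.Binary.Bundles using (Poset)
import Relation.Binary.Construct.Add.Extrema.NonStrict as NonStrictExtrema
import Relation.Binary.Construct.Add.Extrema.Strict as StrictExtrema
import Relation.Binary.Construct.Add.Supremum.NonStrict as AddSupremum
import Relation.Binary.Reasoning.PartialOrder as PartialOrderReasoning
open import Relation.Binary.Structures using (IsTotalOrder)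
open import Relation.Nullary.Construct.Add.Extrema using (⊥±; ⊤±; [_])
open import Relation.Nullary.Decidable.Core using (yes; no; decidable-stable)
open import Relation.Nullary.Negation using (¬_; contradiction)
open import Relation.Unary using (Pred; _⊆_)

-- Arithmetic of ordered fields.

module OrderedField (R : RealField) where

  open RealField R hiding (zero)
  open import Algebra.Properties.Ring ring
  open import Algebra.Solver.Ring.NaturalCoefficients.Default commutativeSemiring using (solve; _:=_; _:+_; _:*_; con)

  poset : Poset 0ℓ 0ℓ 0ℓ
  poset = record { isPartialOrder = IsTotalOrder.isPartialOrder isTotalOrder }

  module ≤-Reasoning = PartialOrderReasoning poset
  open ≤-Reasoning

  <-irrefl : ∀ {x} → ¬ x < x
  <-irrefl (_ , x≉x) = x≉x refl

  +-monoʳ-≤ : ∀ {x y} z → x ≤ y → z + x ≤ z + y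
  +-monoʳ-≤ {x} {y} z x≤y = begin
    z + x ≈⟨ +-comm z x ⟩
    x + z ≤⟨ +-monoˡ-≤ z x≤y ⟩
    y + z ≈⟨ +-comm y z ⟩
    z + y ∎

  +-monoˡ-< : ∀ {x y} z → x < y → x + z < y + z
  +-monoˡ-< z (x≤y , x≉y) = +-monoˡ-≤ z x≤y , λ eq → x≉y (+-cancelʳ z _ _ eq)

  +-monoʳ-< : ∀ {x y} z → x < y → z + x < z + y
  +-monoʳ-< z (x≤y , x≉y) = +-monoʳ-≤ z x≤y , λ eq → x≉y (+-cancelˡ z _ _ eq)

  [x-y]+y≈x : ∀ x y → (x - y) + y ≈ x
  [x-y]+y≈x x y = //-rightDividesˡ y x

  -- Together with `-z<x-y⇒y<x+z`, this unpacks the two halves of a bound of the form |x - y| < z.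
  x-y<z⇒x<y+z : ∀ {x y z} → x - y < z → x < y + z
  x-y<z⇒x<y+z {x} {y} {z} p = begin-strict
    x           ≈⟨ [x-y]+y≈x x y ⟨
    (x - y) + y <⟨ +-monoˡ-< y p ⟩
    z + y       ≈⟨ +-comm z y ⟩
    y + z       ∎

  -z<x-y⇒y<x+z : ∀ {x y z} → - z < x - y → y < x + z
  -z<x-y⇒y<x+z {x} {y} {z} p = begin-strict
    y                 ≈⟨ [x-y]+y≈x y z ⟨
    (y - z) + z       ≈⟨ +-congʳ (+-comm y (- z)) ⟩
    (- z + y) + z     <⟨ +-monoˡ-< z (+-monoˡ-< y p) ⟩
    ((x - y) + y) + z ≈⟨ +-congʳ ([x-y]+y≈x x y) ⟩
    x + z             ∎

  x≤y⇒0≤y-x : ∀ {x y} → x ≤ y → 0# ≤ y - x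
  x≤y⇒0≤y-x {x} {y} x≤y = begin
    0#    ≈⟨ -‿inverseʳ x ⟨
    x - x ≤⟨ +-monoˡ-≤ (- x) x≤y ⟩
    y - x ∎

  x<y⇒0<y-x : ∀ {x y} → x < y → 0# < y - x
  x<y⇒0<y-x {x} {y} x<y = begin-strict
    0#    ≈⟨ -‿inverseʳ x ⟨
    x - x <⟨ +-monoˡ-< (- x) x<y ⟩
    y - x ∎

  0<x⇒-x<0 : ∀ {x} → 0# < x → - x < 0#
  0<x⇒-x<0 {x} 0<x = begin-strict
    - x      ≈⟨ +-identityˡ (- x) ⟨
    0# - x   <⟨ +-monoˡ-< (- x) 0<x ⟩
    x - x    ≈⟨ -‿inverseʳ x ⟩
    0#       ∎

  x<0⇒0<-x : ∀ {x} → x < 0# → 0# < - x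
  x<0⇒0<-x {x} x<0 = begin-strict
    0#     <⟨ x<y⇒0<y-x x<0 ⟩
    0# - x ≈⟨ +-identityˡ (- x) ⟩
    - x    ∎

  *-monoʳ-≤ : ∀ {x y z} → 0# ≤ z → x ≤ y → z * x ≤ z * y
  *-monoʳ-≤ {x} {y} {z} 0≤z x≤y = begin
    z * x                   ≈⟨ +-identityˡ (z * x) ⟨
    0# + z * x              ≤⟨ +-monoˡ-≤ (z * x) (*-nonneg 0≤z (x≤y⇒0≤y-x x≤y)) ⟩
    z * (y - x) + z * x     ≈⟨ distribˡ z (y - x) x ⟨
    z * ((y - x) + x)       ≈⟨ *-congˡ ([x-y]+y≈x y x) ⟩
    z * y                   ∎

  *-cancelˡ-≈ : ∀ {x y z} → z ≉ 0# → z * x ≈ z * y → x ≈ y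
  *-cancelˡ-≈ {x} {y} {z} z≉0 eq = begin-equality
    x              ≈⟨ recover x ⟩
    z ⁻¹ * (z * x) ≈⟨ *-congˡ eq ⟩
    z ⁻¹ * (z * y) ≈⟨ recover y ⟨
    y              ∎
    where
    recover : ∀ u → u ≈ z ⁻¹ * (z * u)
    recover u = begin-equality
      u              ≈⟨ *-identityˡ u ⟨
      1# * u         ≈⟨ *-congʳ (⁻¹-inverseʳ z≉0) ⟨
      (z * z ⁻¹) * u ≈⟨ solve 3 (λ z i u → (z :* i) :* u := i :* (z :* u)) refl z (z ⁻¹) u ⟩
      z ⁻¹ * (z * u) ∎

  0<x⇒x≉0 : ∀ {x} → 0# < x → x ≉ 0#
  0<x⇒x≉0 (_ , 0≉x) x≈0 = 0≉x (sym x≈0)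

  *-monoʳ-< : ∀ {x y z} → 0# < z → x < y → z * x < z * y
  *-monoʳ-< 0<z (x≤y , x≉y) =
    *-monoʳ-≤ (proj₁ 0<z) x≤y , λ eq → x≉y (*-cancelˡ-≈ (0<x⇒x≉0 0<z) eq)

  *-pos : ∀ {x y} → 0# < x → 0# < y → 0# < x * y
  *-pos {x} {y} 0<x 0<y = begin-strict
    0#     ≈⟨ zeroʳ x ⟨
    x * 0# <⟨ *-monoʳ-< 0<x 0<y ⟩
    x * y  ∎

  -- If `1# ≤ 0#`, then `- 1#` is nonnegative, hence so is its square, which is `1#`. Either case of
  -- totality thus ends in `0# ≤ 1#`.
  0<1 : 0# < 1#
  0<1 with ≤-total 0# 1#
  ... | inj₁ 0≤1 = 0≤1 , 0≉1
  ... | inj₂ 1≤0 = (begin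
      0#          ≤⟨ *-nonneg 0≤-1 0≤-1 ⟩
      - 1# * - 1# ≈⟨ -1*x≈-x (- 1#) ⟩
      - - 1#      ≈⟨ -‿involutive 1# ⟩
      1#          ∎) , 0≉1
    where
    0≤-1 : 0# ≤ - 1#
    0≤-1 = begin
      0#      ≤⟨ x≤y⇒0≤y-x 1≤0 ⟩
      0# - 1# ≈⟨ +-identityˡ (- 1#) ⟩
      - 1#    ∎

  0<1+x : ∀ {x} → 0# ≤ x → 0# < 1# + x
  0<1+x {x} 0≤x = begin-strict
    0#      <⟨ 0<1 ⟩
    1#      ≈⟨ +-identityʳ 1# ⟨
    1# + 0# ≤⟨ +-monoʳ-≤ 1# 0≤x ⟩
    1# + x  ∎

  -- A nonpositive inverse would make the product `x * x ⁻¹`, which is 1, nonpositive. An inverse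
  -- equal to zero would make it zero.
  ⁻¹-pos : ∀ {x} → 0# < x → 0# < x ⁻¹
  ⁻¹-pos {x} 0<x with ≤-total 0# (x ⁻¹)
  ... | inj₁ 0≤x⁻¹ = 0≤x⁻¹ , λ 0≈x⁻¹ → 0≉1 (begin-equality
    0#       ≈⟨ zeroʳ x ⟨
    x * 0#   ≈⟨ *-congˡ 0≈x⁻¹ ⟩
    x * x ⁻¹ ≈⟨ ⁻¹-inverseʳ (0<x⇒x≉0 0<x) ⟩
    1#       ∎)
  ... | inj₂ x⁻¹≤0 = contradiction (begin-strict
    0#       <⟨ 0<1 ⟩
    1#       ≈⟨ ⁻¹-inverseʳ (0<x⇒x≉0 0<x) ⟨
    x * x ⁻¹ ≤⟨ *-monoʳ-≤ (proj₁ 0<x) x⁻¹≤0 ⟩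
    x * 0#   ≈⟨ zeroʳ x ⟩
    0#       ∎) <-irrefl

  x<yz⁻¹⇒zx<y : ∀ {x y z} → 0# < z → x < y * z ⁻¹ → z * x < y
  x<yz⁻¹⇒zx<y {x} {y} {z} 0<z x<y/z = begin-strict
    z * x            <⟨ *-monoʳ-< 0<z x<y/z ⟩
    z * (y * z ⁻¹)   ≈⟨ solve 3 (λ z y i → z :* (y :* i) := y :* (z :* i)) refl z y (z ⁻¹) ⟩
    y * (z * z ⁻¹)   ≈⟨ *-congˡ (⁻¹-inverseʳ (0<x⇒x≉0 0<z)) ⟩
    y * 1#           ≈⟨ *-identityʳ y ⟩
    y                ∎

  xz⁻¹<y⇒x<zy : ∀ {x y z} → 0# < z → x * z ⁻¹ < y → x < z * y
  xz⁻¹<y⇒x<zy {x} {y} {z} 0<z x/z<y = begin-strict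
    x                ≈⟨ *-identityʳ x ⟨
    x * 1#           ≈⟨ *-congˡ (⁻¹-inverseʳ (0<x⇒x≉0 0<z)) ⟨
    x * (z * z ⁻¹)   ≈⟨ solve 3 (λ z x i → x :* (z :* i) := z :* (x :* i)) refl z x (z ⁻¹) ⟩
    z * (x * z ⁻¹)   <⟨ *-monoʳ-< 0<z x/z<y ⟩
    z * y            ∎

  ½ : Carrier
  ½ = (1# + 1#) ⁻¹

  0<½ : 0# < ½
  0<½ = ⁻¹-pos (0<1+x (proj₁ 0<1))

  x½+x½≈x : ∀ x → x * ½ + x * ½ ≈ x
  x½+x½≈x x = begin-equality
    x * ½ + x * ½     ≈⟨ solve 2 (λ x h → x :* h :+ x :* h := x :* ((con 1 :+ con 1) :* h)) refl x ½ ⟩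
    x * ((1# + 1#) * ½) ≈⟨ *-congˡ (⁻¹-inverseʳ (0<x⇒x≉0 (0<1+x (proj₁ 0<1)))) ⟩
    x * 1#            ≈⟨ *-identityʳ x ⟩
    x                 ∎

  -- If y < x, half of the gap x - y as ε yields x < x. The slack is written `ε + ε` because two
  -- separate errors of size ε arise when derivatives are compared.
  ≤-by-slack : ExcludedMiddle 0ℓ → ∀ {x y} →
               (∀ ε → 0# < ε → x < y + (ε + ε)) → x ≤ y
  ≤-by-slack em {x} {y} slack with ≤-total x y | em {y ≈ x}
  ... | inj₁ x≤y | _       = x≤y
  ... | inj₂ _   | yes y≈x = ≤-reflexive (sym y≈x)
  ... | inj₂ y≤x | no  y≉x = contradiction (begin-strict
    x             <⟨ slack ε (*-pos (x<y⇒0<y-x (y≤x , y≉x)) 0<½) ⟩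
    y + (ε + ε)   ≈⟨ +-congˡ (x½+x½≈x (x - y)) ⟩
    y + (x - y)   ≈⟨ +-comm y (x - y) ⟩
    (x - y) + y   ≈⟨ [x-y]+y≈x x y ⟩
    x             ∎) <-irrefl
    where
    ε = (x - y) * ½

  -- Properties of all sufficiently small positive parameters.

  Eventually : Pred Carrier 0ℓ → Set
  Eventually P = ∃ λ η → 0# < η × (∀ t → 0# < t → t < η → P t)

  eventually-∧ : ∀ {P Q} → Eventually P → Eventually Q → Eventually (λ t → P t × Q t)
  eventually-∧ (η , 0<η , p) (θ , 0<θ , q) with ≤-total η θ
  ... | inj₁ η≤θ = η , 0<η , λ t 0<t t<η →
    p t 0<t t<η , q t 0<t (begin-strict t <⟨ t<η ⟩ η ≤⟨ η≤θ ⟩ θ ∎)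
  ... | inj₂ θ≤η = θ , 0<θ , λ t 0<t t<θ →
    p t 0<t (begin-strict t <⟨ t<θ ⟩ θ ≤⟨ θ≤η ⟩ η ∎) , q t 0<t t<θ

  eventually-∀ : ∀ {n} {P : Fin n → Pred Carrier 0ℓ} →
                 (∀ i → Eventually (P i)) → Eventually (λ t → ∀ i → P i t)
  eventually-∀ {ℕ.zero}  _ = 1# , 0<1 , λ _ _ _ ()
  eventually-∀ {ℕ.suc n} p =
    let (η , 0<η , q) = eventually-∧ (p zero) (eventually-∀ λ i → p (suc i)) in
    η , 0<η , λ t 0<t t<η → λ where
      zero    → proj₁ (q t 0<t t<η)
      (suc i) → proj₂ (q t 0<t t<η) i

  eventually-witness : ∀ {P} → Eventually P → ∃ λ t → 0# < t × P t
  eventually-witness (η , 0<η , p) = t , 0<t , p t 0<t (begin-strict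
    t       ≈⟨ +-identityʳ t ⟨
    t + 0#  <⟨ +-monoʳ-< t 0<t ⟩
    t + t   ≈⟨ x½+x½≈x η ⟩
    η       ∎)
    where
    t = η * ½
    0<t = *-pos 0<η 0<½

  -- For a ≥ 0 the threshold is c / (1 + a): the added 1 keeps the divisor positive when a = 0, and
  -- t a < t (1 + a) < c. For a ≤ 0 the product is never positive.
  eventually-small : ∀ a {c} → 0# < c → Eventually (λ t → t * a < c)
  eventually-small a {c} 0<c with ≤-total 0# a
  ... | inj₁ 0≤a = c * (1# + a) ⁻¹ , *-pos 0<c (⁻¹-pos (0<1+x 0≤a)) , λ t 0<t t<η →
    begin-strict
      t * a        ≈⟨ +-identityˡ (t * a) ⟨
      0# + t * a   <⟨ +-monoˡ-< (t * a) 0<t ⟩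
      t + t * a    ≈⟨ solve 2 (λ t a → t :+ t :* a := (con 1 :+ a) :* t) refl t a ⟩
      (1# + a) * t <⟨ x<yz⁻¹⇒zx<y (0<1+x 0≤a) t<η ⟩
      c            ∎
  ... | inj₂ a≤0 = 1# , 0<1 , λ t 0<t _ → begin-strict
    t * a  ≤⟨ *-monoʳ-≤ (proj₁ 0<t) a≤0 ⟩
    t * 0# ≈⟨ zeroʳ t ⟩
    0#     <⟨ 0<c ⟩
    c      ∎

  -- On the boundary x = 0 the sign condition on a suffices for every t > 0. In the interior x > 0
  -- leaves room, and t (-a) < x for small t.
  eventually-nonneg : ExcludedMiddle 0ℓ → ∀ {x} a → 0# ≤ x → (x ≈ 0# → 0# ≤ a) →
                      Eventually (λ t → 0# ≤ x + t * a)
  eventually-nonneg em {x} a 0≤x tangent with em {x ≈ 0#}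
  ... | yes x≈0 = 1# , 0<1 , λ t 0<t _ → begin
    0#         ≤⟨ *-nonneg (proj₁ 0<t) (tangent x≈0) ⟩
    t * a      ≈⟨ +-identityˡ (t * a) ⟨
    0# + t * a ≈⟨ +-congʳ x≈0 ⟨
    x + t * a  ∎
  ... | no x≉0 =
    let (η , 0<η , small) = eventually-small (- a) (0≤x , λ 0≈x → x≉0 (sym 0≈x)) in
    η , 0<η , λ t 0<t t<η → begin
      0#              ≈⟨ zeroʳ t ⟨
      t * 0#          ≈⟨ *-congˡ (-‿inverseˡ a) ⟨
      t * (- a + a)   ≈⟨ distribˡ t (- a) a ⟩
      t * - a + t * a ≤⟨ +-monoˡ-≤ (t * a) (proj₁ (small t 0<t t<η)) ⟩
      x + t * a       ∎

-- Extended-real thresholds, finite sums, and motion along lines in the box.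

module Directions (R : RealField) where

  open RealField R hiding (zero)
  open Analysis R
  open OrderedField R
  open ≤-Reasoning
  open import Algebra.Properties.Ring ring
  open import Algebra.Properties.Semiring.Sum semiring
  open import Algebra.Solver.Ring.NaturalCoefficients.Default commutativeSemiring using (solve; _:=_; _:+_; _:*_; con)

  -- Both infinite cases are vacuous: `⊥±` lies above no real x, and `⊤±` lies below no real γ.
  -- Hence s is finite, and the division by δ > 0 can be undone.
  /±-<⇒< : ∀ {x δ γ} s → 0# < δ → [ x ] ≤± s → s /± δ <± [ γ ] → x < δ * γ
  /±-<⇒< ⊥±    _   (AddSupremum.[ () ]) _
  /±-<⇒< ⊤±    _   _ ()
  /±-<⇒< {x} {δ} {γ} [ s ] 0<δ x≤s s/δ<γ = begin-strict
    x     ≤⟨ NonStrictExtrema.[≤]-injective _≤_ x≤s ⟩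
    s     <⟨ xz⁻¹<y⇒x<zy 0<δ (StrictExtrema.[<]-injective _<_ s/δ<γ) ⟩
    δ * γ ∎

  sum-zero : ∀ {n} (f : Fin n → Carrier) → (∀ i → f i ≈ 0#) → sum f ≈ 0#
  sum-zero {n} f f≈0 = trans (sum-cong-≋ f≈0) (sum-replicate-zero n)

  -- Linearity of the sum in the shape of a second-degree expansion in t. It serves once for the
  -- inner and once for the outer sum of a bilinear form.
  sum-quadratic : ∀ {n} t (p q r s : Fin n → Carrier) →
    sum (λ i → p i + t * ((q i + r i) + t * s i)) ≈
    sum p + t * ((sum q + sum r) + t * sum s)
  sum-quadratic {n} t p q r s = begin-equality
    sum (λ i → p i + t * ((q i + r i) + t * s i))
      ≈⟨ ∑-distrib-+ p _ ⟩
    sum p + sum (λ i → t * ((q i + r i) + t * s i))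
      ≈⟨ +-congˡ (*-distribˡ-sum {n} t _) ⟨
    sum p + t * sum (λ i → (q i + r i) + t * s i)
      ≈⟨ +-congˡ (*-congˡ (∑-distrib-+ (λ i → q i + r i) _)) ⟩
    sum p + t * (sum (λ i → q i + r i) + sum (λ i → t * s i))
      ≈⟨ +-congˡ (*-congˡ (+-cong (∑-distrib-+ q r) (sym (*-distribˡ-sum {n} t s)))) ⟩
    sum p + t * ((sum q + sum r) + t * sum s) ∎

  module _ {N : ℕ} where

    line : ℝ^ N → Carrier → ℝ^ N → ℝ^ N
    line z t d i = z i + t * d i

    basis : Fin N → ℝ^ N
    basis i = updateAt (λ _ → 0#) i (λ _ → 1#)

    ⟨⟩-line : ∀ w z t d → ⟨ w , line z t d ⟩ ≈ ⟨ w , z ⟩ + t * ⟨ w , d ⟩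
    ⟨⟩-line w z t d = begin-equality
      sum (λ i → w i * (z i + t * d i))
        ≈⟨ sum-cong-≋ (λ i → solve 4 (λ w z t d → w :* (z :+ t :* d) := w :* z :+ t :* (w :* d)) refl (w i) (z i) t (d i)) ⟩
      sum (λ i → w i * z i + t * (w i * d i))
        ≈⟨ ∑-distrib-+ (λ i → w i * z i) _ ⟩
      ⟨ w , z ⟩ + sum (λ i → t * (w i * d i))
        ≈⟨ +-congˡ (*-distribˡ-sum {N} t _) ⟨
      ⟨ w , z ⟩ + t * ⟨ w , d ⟩ ∎

    ‖line-z‖² : ∀ z t d → ‖ (λ i → line z t d i - z i) ‖² ≈ t * (t * ‖ d ‖²)
    ‖line-z‖² z t d = begin-equality
      ‖ (λ i → line z t d i - z i) ‖²
        ≈⟨ sum-cong-≋ (λ i → *-cong (xyx⁻¹≈y (z i) (t * d i)) (xyx⁻¹≈y (z i) (t * d i))) ⟩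
      sum (λ i → (t * d i) * (t * d i))
        ≈⟨ sum-cong-≋ (λ i → solve 2 (λ t d → (t :* d) :* (t :* d) := (t :* t) :* (d :* d)) refl t (d i)) ⟩
      sum (λ i → (t * t) * (d i * d i))
        ≈⟨ *-distribˡ-sum {N} (t * t) _ ⟨
      (t * t) * ‖ d ‖²
        ≈⟨ *-assoc t t _ ⟩
      t * (t * ‖ d ‖²) ∎

    -- Each face is an instance of `eventually-nonneg`: the lower one with z i and slope d i, the
    -- upper one with 1 - z i and slope - d i. Finitely many coordinates share a common threshold.
    eventually-Box : ExcludedMiddle 0ℓ → ∀ {z d} → Box z → TangentCone z d →
                     Eventually (λ t → Box (line z t d))
    eventually-Box em {z} {d} box tangent = eventually-∀ λ i →
      let (η , 0<η , p) = eventually-∧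
            (eventually-nonneg em (d i) (proj₁ (box i)) (proj₁ (tangent i)))
            (eventually-nonneg em (- d i) (x≤y⇒0≤y-x (proj₂ (box i))) (λ eq → begin
              0#         ≤⟨ x≤y⇒0≤y-x (proj₂ (tangent i) (sym (x∙y⁻¹≈ε⇒x≈y 1# (z i) eq))) ⟩
              0# - d i   ≈⟨ +-identityˡ (- d i) ⟩
              - d i      ∎))
      in η , 0<η , λ t 0<t t<η →
        proj₁ (p t 0<t t<η) , (begin
          z i + t * d i
            ≈⟨ +-identityˡ _ ⟨
          0# + (z i + t * d i)
            ≤⟨ +-monoˡ-≤ _ (proj₂ (p t 0<t t<η)) ⟩
          ((1# - z i) + t * - d i) + (z i + t * d i)
            -- The solver handles semiring identities, so `1# - z i` and `- d i` enter as atoms and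
            -- are cancelled afterwards.
            ≈⟨ solve 5 (λ a z t e d → (a :+ t :* e) :+ (z :+ t :* d) := (a :+ z) :+ t :* (e :+ d)) refl (1# - z i) (z i) t (- d i) (d i) ⟩
          ((1# - z i) + z i) + t * (- d i + d i)
            ≈⟨ +-cong ([x-y]+y≈x 1# (z i)) (trans (*-congˡ (-‿inverseˡ (d i))) (zeroʳ t)) ⟩
          1# + 0#
            ≈⟨ +-identityʳ 1# ⟩
          1# ∎)

    -- The squared distance is t²‖d‖². One factor t brings t‖d‖² below ε², and the remaining one is
    -- absorbed by t ε² < ε², which amounts to t < 1.
    eventually-near : ∀ z d {ε} → 0# < ε →
      Eventually (λ t → ‖ (λ i → line z t d i - z i) ‖² < ε * ε)
    eventually-near z d {ε} 0<ε =
      let 0<ε² = *-pos 0<ε 0<ε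
          (η , 0<η , p) = eventually-∧ (eventually-small ‖ d ‖² 0<ε²) (eventually-small (ε * ε) 0<ε²)
      in η , 0<η , λ t 0<t t<η → begin-strict
        ‖ (λ i → line z t d i - z i) ‖² ≈⟨ ‖line-z‖² z t d ⟩
        t * (t * ‖ d ‖²)                <⟨ *-monoʳ-< 0<t (proj₁ (p t 0<t t<η)) ⟩
        t * (ε * ε)                     <⟨ proj₂ (p t 0<t t<η) ⟩
        ε * ε                           ∎

    -- The first-order condition for functions that are quadratic along lines.
    localMinimizer⇒slope≮0 : ExcludedMiddle 0ℓ → ∀ {f z d} s k →
      (∀ t → f (line z t d) ≈ f z + t * (s + t * k)) →
      TangentCone z d → IsLocalMinimizer f z → ¬ s < 0#
    localMinimizer⇒slope≮0 em {f} {z} {d} s k expand tangent (box , ε , 0<ε , minimal) s<0 =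
      let (t , 0<t , (inBox , near) , small) = eventually-witness
            (eventually-∧ (eventually-∧ (eventually-Box em box tangent) (eventually-near z d 0<ε))
                          (eventually-small k (x<0⇒0<-x s<0)))
      in <-irrefl (begin-strict
        f z                     ≤⟨ minimal (line z t d) inBox near ⟩
        f (line z t d)          ≈⟨ expand t ⟩
        f z + t * (s + t * k)   <⟨ +-monoʳ-< (f z) (*-monoʳ-< 0<t (+-monoʳ-< s small)) ⟩
        f z + t * (s - s)       ≈⟨ +-congˡ (trans (*-congˡ (-‿inverseʳ s)) (zeroʳ t)) ⟩
        f z + 0#                ≈⟨ +-identityʳ (f z) ⟩
        f z                     ∎)

  -- Turns the perturbation of one coordinate in `IsPartialDerivative` into motion along a basis
  -- vector, so that expansions along lines apply to partial derivatives.
  updateAt-+≈line : ∀ {N} (z : ℝ^ N) i t j → updateAt z i (_+ t) j ≈ line z t (basis i) j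
  updateAt-+≈line z zero    t zero    = +-congˡ (sym (*-identityʳ t))
  updateAt-+≈line z zero    t (suc j) = sym (trans (+-congˡ (zeroʳ t)) (+-identityʳ _))
  updateAt-+≈line z (suc i) t zero    = sym (trans (+-congˡ (zeroʳ t)) (+-identityʳ _))
  updateAt-+≈line z (suc i) t (suc j) = updateAt-+≈line (λ k → z (suc k)) i t j

  ⟨g,basis⟩ : ∀ {N} (g : ℝ^ N) i → ⟨ g , basis i ⟩ ≈ g i
  ⟨g,basis⟩ g zero    =
    trans (+-cong (*-identityʳ (g zero)) (sum-zero _ λ i → zeroʳ (g (suc i)))) (+-identityʳ _)
  ⟨g,basis⟩ g (suc i) =
    trans (+-cong (zeroʳ (g zero)) (⟨g,basis⟩ (λ k → g (suc k)) i)) (+-identityˡ _)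

  -- Quadratic polynomials: expansion along lines and identification of the gradient.

  module Quadratic {N : ℕ} (Q : Fin N → Fin N → Carrier) (b : ℝ^ N) (c : Carrier) where

    bilinear : ℝ^ N → ℝ^ N → Carrier
    bilinear x y = sum λ i → sum λ j → Q i j * (x i * y j)

    poly : ℝ^ N → Carrier
    poly z = bilinear z z + ⟨ b , z ⟩ + c

    -- The formal gradient (Q + Qᵀ) z + b; the matrix Q may be asymmetric.
    ∇poly : ℝ^ N → ℝ^ N
    ∇poly z i = (sum (λ j → Q i j * z j) + sum (λ j → Q j i * z j)) + b i

    -- Vectors are functions, and V is not assumed to respect their pointwise equality. That
    -- property is transferred to V from `poly`.
    poly-cong : ∀ {x y} → (∀ i → x i ≈ y i) → poly x ≈ poly y
    poly-cong x≈y = +-congʳ (+-cong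
      (sum-cong-≋ λ i → sum-cong-≋ λ j → *-congˡ (*-cong (x≈y i) (x≈y j)))
      (sum-cong-≋ λ i → *-congˡ (x≈y i)))

    ⟨∇poly,d⟩ : ∀ z d → ⟨ ∇poly z , d ⟩ ≈ (bilinear d z + bilinear z d) + ⟨ b , d ⟩
    ⟨∇poly,d⟩ z d = begin-equality
      ⟨ ∇poly z , d ⟩
        ≈⟨ sum-cong-≋ (λ i → trans (distribʳ (d i) _ (b i)) (+-congʳ (distribʳ (d i) _ _))) ⟩
      sum (λ i → (row i * d i + col i * d i) + b i * d i)
        ≈⟨ ∑-distrib-+ (λ i → row i * d i + col i * d i) _ ⟩
      sum (λ i → row i * d i + col i * d i) + ⟨ b , d ⟩
        ≈⟨ +-congʳ (∑-distrib-+ (λ i → row i * d i) _) ⟩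
      (sum (λ i → row i * d i) + sum (λ i → col i * d i)) + ⟨ b , d ⟩
        ≈⟨ +-congʳ (+-cong rows cols) ⟩
      (bilinear d z + bilinear z d) + ⟨ b , d ⟩ ∎
      where
      row col : ℝ^ N
      row i = sum λ j → Q i j * z j
      col i = sum λ j → Q j i * z j

      rows : sum (λ i → row i * d i) ≈ bilinear d z
      rows = sum-cong-≋ λ i → trans (*-distribʳ-sum {N} (d i) _) (sum-cong-≋ λ j →
        solve 3 (λ q z d → (q :* z) :* d := q :* (d :* z)) refl (Q i j) (z j) (d i))

      -- The transposed part of the gradient becomes a value of `bilinear` once the order of
      -- summation is exchanged.
      cols : sum (λ i → col i * d i) ≈ bilinear z d
      cols = trans
        (sum-cong-≋ λ i → trans (*-distribʳ-sum {N} (d i) _) (sum-cong-≋ λ j →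
          *-assoc (Q j i) (z j) (d i)))
        (∑-comm λ i j → Q j i * (z j * d i))

    bilinear-line : ∀ z t d → bilinear (line z t d) (line z t d) ≈
      bilinear z z + t * ((bilinear d z + bilinear z d) + t * bilinear d d)
    bilinear-line z t d = trans
      (sum-cong-≋ λ i → trans
        (sum-cong-≋ λ j →
          solve 6 (λ q x y t u v →
              q :* ((x :+ t :* u) :* (y :+ t :* v)) :=
              q :* (x :* y) :+ t :* ((q :* (u :* y) :+ q :* (x :* v)) :+ t :* (q :* (u :* v))))
            refl (Q i j) (z i) (z j) t (d i) (d j))
        (sum-quadratic {N} t _ _ _ _))
      (sum-quadratic {N} t _ _ _ _)

    -- The Taylor expansion at z, exact because the degree is two: the coefficient of t² is the
    -- quadratic form at d.
    poly-line : ∀ z t d →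
      poly (line z t d) ≈ poly z + t * (⟨ ∇poly z , d ⟩ + t * bilinear d d)
    poly-line z t d = begin-equality
      poly (line z t d)
        ≈⟨ +-congʳ (+-cong (bilinear-line z t d) (⟨⟩-line b z t d)) ⟩
      (bilinear z z + t * ((bilinear d z + bilinear z d) + t * bilinear d d)
        + (⟨ b , z ⟩ + t * ⟨ b , d ⟩)) + c
        ≈⟨ solve 7 (λ p t s k l m c →
               ((p :+ t :* (s :+ t :* k)) :+ (l :+ t :* m)) :+ c :=
               ((p :+ l) :+ c) :+ t :* ((s :+ m) :+ t :* k))
             refl (bilinear z z) t (bilinear d z + bilinear z d) (bilinear d d)
                  ⟨ b , z ⟩ ⟨ b , d ⟩ c ⟩
      poly z + t * (((bilinear d z + bilinear z d) + ⟨ b , d ⟩) + t * bilinear d d)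
        ≈⟨ +-congˡ (*-congˡ (+-congʳ (⟨∇poly,d⟩ z d))) ⟨
      poly z + t * (⟨ ∇poly z , d ⟩ + t * bilinear d d) ∎

    module _ (V : ℝ^ N → Carrier) (V≈poly : ∀ z → V z ≈ poly z) where

      V-line : ∀ z t d → V (line z t d) ≈ V z + t * (⟨ ∇poly z , d ⟩ + t * bilinear d d)
      V-line z t d = begin-equality
        V (line z t d)    ≈⟨ V≈poly (line z t d) ⟩
        poly (line z t d) ≈⟨ poly-line z t d ⟩
        poly z + t * (⟨ ∇poly z , d ⟩ + t * bilinear d d) ≈⟨ +-congʳ (V≈poly z) ⟨
        V z + t * (⟨ ∇poly z , d ⟩ + t * bilinear d d) ∎

      -- The exact expansion makes the quotient affine in t, so its limit at 0 can be read off as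
      -- the constant term.
      differenceQuotient : ∀ z i t → t ≉ 0# →
        (V (updateAt z i (_+ t)) - V z) * t ⁻¹ ≈
        ∇poly z i + t * bilinear (basis i) (basis i)
      differenceQuotient z i t t≉0 = begin-equality
        (V (updateAt z i (_+ t)) - V z) * t ⁻¹
          ≈⟨ *-congʳ (+-congʳ (trans (V≈poly _) (trans (poly-cong (updateAt-+≈line z i t)) (sym (V≈poly _))))) ⟩
        (V (line z t (basis i)) - V z) * t ⁻¹
          ≈⟨ *-congʳ (+-congʳ (V-line z t (basis i))) ⟩
        ((V z + t * m) - V z) * t ⁻¹
          ≈⟨ *-congʳ (xyx⁻¹≈y (V z) (t * m)) ⟩
        (t * m) * t ⁻¹
          ≈⟨ solve 3 (λ t m i → (t :* m) :* i := m :* (t :* i)) refl t m (t ⁻¹) ⟩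
        m * (t * t ⁻¹)
          ≈⟨ *-congˡ (⁻¹-inverseʳ t≉0) ⟩
        m * 1#
          ≈⟨ *-identityʳ m ⟩
        m
          ≈⟨ +-congʳ (⟨g,basis⟩ (∇poly z) i) ⟩
        ∇poly z i + t * bilinear (basis i) (basis i) ∎
        where
        m = ⟨ ∇poly z , basis i ⟩ + t * bilinear (basis i) (basis i)

      -- For small t > 0 the quotient G + t k is within ε of a. A second ε absorbs t k for the bound
      -- a ≤ G, and - t k for the bound G ≤ a.
      partialDerivative-unique : ExcludedMiddle 0ℓ → ∀ z i {a} →
        IsPartialDerivative V z i a → a ≈ ∇poly z i
      partialDerivative-unique em z i {a} isPD = ≤-antisym
        (≤-by-slack em λ ε 0<ε →
          let (t , 0<t , (lower , _) , small) = eventually-witness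
                (eventually-∧ (close ε 0<ε) (eventually-small k 0<ε))
          in begin-strict
            a                 <⟨ -z<x-y⇒y<x+z lower ⟩
            (G + t * k) + ε   <⟨ +-monoˡ-< ε (+-monoʳ-< G small) ⟩
            (G + ε) + ε       ≈⟨ +-assoc G ε ε ⟩
            G + (ε + ε)       ∎)
        (≤-by-slack em λ ε 0<ε →
          let (t , 0<t , (_ , upper) , small) = eventually-witness
                (eventually-∧ (close ε 0<ε) (eventually-small (- k) 0<ε))
          in begin-strict
            G                       ≈⟨ +-identityʳ G ⟨
            G + 0#                  ≈⟨ +-congˡ (trans (*-congˡ (-‿inverseʳ k)) (zeroʳ t)) ⟨
            G + t * (k - k)         ≈⟨ solve 4 (λ G t k l → G :+ t :* (k :+ l) := (G :+ t :* k) :+ t :* l) refl G t k (- k) ⟩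
            (G + t * k) + t * - k   <⟨ +-monoˡ-< (t * - k) (x-y<z⇒x<y+z upper) ⟩
            (a + ε) + t * - k       <⟨ +-monoʳ-< (a + ε) small ⟩
            (a + ε) + ε             ≈⟨ +-assoc a ε ε ⟩
            a + (ε + ε)             ∎)
        where
        G k : Carrier
        G = ∇poly z i
        k = bilinear (basis i) (basis i)

        -- The two-sided limit is restricted to positive increments, and the quotient is replaced by
        -- its affine form.
        close : ∀ ε → 0# < ε → Eventually (λ t → ∣ (G + t * k) - a ∣< ε)
        close ε 0<ε =
          let (η , 0<η , p) = isPD ε 0<ε in
          η , 0<η , λ t 0<t t<η →
            let t≉0 = 0<x⇒x≉0 0<t
                (lower , upper) = p t t≉0
                  ((begin-strict - η <⟨ 0<x⇒-x<0 0<η ⟩ 0# <⟨ 0<t ⟩ t ∎) , t<η)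
                eq = +-congʳ (differenceQuotient z i t t≉0)
            in (begin-strict - ε <⟨ lower ⟩ _ ≈⟨ eq ⟩ (G + t * k) - a ∎)
             , (begin-strict (G + t * k) - a ≈⟨ eq ⟨ _ <⟨ upper ⟩ ε ∎)

      -- Puts the objective into the form that `localMinimizer⇒slope≮0` expects; the coefficient of
      -- t is the slope in direction d.
      objective-line : ∀ w γ z t d → objective w V γ (line z t d) ≈
        objective w V γ z +
        t * ((⟨ w , d ⟩ + γ * ⟨ ∇poly z , d ⟩) + t * (γ * bilinear d d))
      objective-line w γ z t d = begin-equality
        objective w V γ (line z t d)
          ≈⟨ +-cong (⟨⟩-line w z t d) (*-congˡ (V-line z t d)) ⟩
        (⟨ w , z ⟩ + t * ⟨ w , d ⟩) + γ * (V z + t * (⟨ ∇poly z , d ⟩ + t * bilinear d d))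
          ≈⟨ solve 7 (λ wz t wd γ v s k →
                 (wz :+ t :* wd) :+ γ :* (v :+ t :* (s :+ t :* k)) :=
                 (wz :+ γ :* v) :+ t :* ((wd :+ γ :* s) :+ t :* (γ :* k)))
               refl ⟨ w , z ⟩ t ⟨ w , d ⟩ γ (V z) ⟨ ∇poly z , d ⟩ (bilinear d d) ⟩
        objective w V γ z +
        t * ((⟨ w , d ⟩ + γ * ⟨ ∇poly z , d ⟩) + t * (γ * bilinear d d)) ∎

-- Feasibility of local minimizers above the penalty threshold.

theorem2p7 : (em : ExcludedMiddle 0ℓ) (R : RealField) →
    let open RealField R
        open Analysis R in
    (N : ℕ) → N ℕ.≥ 1 →
    (w : ℝ^ N) →
    (V : ℝ^ N → Carrier) → IsQuadraticPolynomial V →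
    (F : Pred (CoreVector w) 0ℓ) → F ⊆ Binary w →
    (D : Pred (ℝ^ N) 0ℓ) → Bounded D →
    (δ : Carrier) → 0# < δ → LocallyRepairable w F V D δ →
    (γ : Carrier) → 0# ≤ γ →
    (∀ z → IsLocalMinimizer (objective w V γ) z → Binary w (core w z)) →
    sup em (LinearGains w F D) /± δ <± [ γ ] →
    ∀ z → IsLocalMinimizer (objective w V γ) z → F (core w z)
theorem2p7 em R N _ w V (Q , b , c , V≈poly) F _ D _ δ 0<δ repairable γ 0≤γ binary L/δ<γ z min =
  -- F is an arbitrary predicate, so excluded middle removes the double negation and permits an
  -- argument by contradiction.
  decidable-stable em not-infeasible
  where
  open RealField R
  open Analysis R
  open OrderedField R
  open Directions R
  open Quadratic Q b c
  open ≤-Reasoning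
  open import Algebra.Properties.Ring ring
  open import Algebra.Properties.Semiring.Sum semiring using (sum-cong-≋)

  not-infeasible : ¬ ¬ F (core w z)
  not-infeasible infeasible =
    localMinimizer⇒slope≮0 em slope (γ * bilinear d d)
      (λ t → objective-line V V≈poly w γ z t d) tangent min slope<0
    where
    box : Box z
    box = proj₁ min

    -- Core binarity at the local minimizer places z among the points to which repairability
    -- applies.
    infeasibleBinary : InfeasibleBinary w F (core w z)
    infeasibleBinary = binary z min , infeasible

    repair = repairable z box infeasibleBinary

    g d : ℝ^ N
    g = proj₁ repair
    d = proj₁ (proj₂ (proj₂ repair))

    d∈D = proj₁ (proj₂ (proj₂ (proj₂ repair)))
    tangent = proj₁ (proj₂ (proj₂ (proj₂ (proj₂ repair))))

    -- Repairability bounds the slope through some analytic gradient g; uniqueness of partial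
    -- derivatives carries the bound over to the formal gradient.
    ⟨∇poly,d⟩≤-δ : ⟨ ∇poly z , d ⟩ ≤ - δ
    ⟨∇poly,d⟩≤-δ = begin
      ⟨ ∇poly z , d ⟩ ≈⟨ sum-cong-≋ (λ i → *-congʳ (partialDerivative-unique V V≈poly em z i (proj₁ (proj₂ repair) i))) ⟨
      ⟨ g , d ⟩       ≤⟨ proj₂ (proj₂ (proj₂ (proj₂ (proj₂ repair)))) ⟩
      - δ             ∎

    ⟨w,d⟩<δγ : ⟨ w , d ⟩ < δ * γ
    -- The pair z, d witnesses that ⟨ w , d ⟩ is among the values whose supremum is L, so it is at
    -- most L.
    ⟨w,d⟩<δγ = /±-<⇒< (sup em (LinearGains w F D)) 0<δ
      (proj₁ (proj₂ (sup-exists em (LinearGains w F D))) ⟨ w , d ⟩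
        (z , d , box , infeasibleBinary , d∈D , tangent , refl))
      L/δ<γ

    slope : Carrier
    slope = ⟨ w , d ⟩ + γ * ⟨ ∇poly z , d ⟩

    slope<0 : slope < 0#
    slope<0 = begin-strict
      -- Here `0≤γ` lets the repair margin be scaled by γ. The strictness then comes from the
      -- threshold.
      ⟨ w , d ⟩ + γ * ⟨ ∇poly z , d ⟩ ≤⟨ +-monoʳ-≤ ⟨ w , d ⟩ (*-monoʳ-≤ 0≤γ ⟨∇poly,d⟩≤-δ) ⟩
      ⟨ w , d ⟩ + γ * - δ             <⟨ +-monoˡ-< (γ * - δ) ⟨w,d⟩<δγ ⟩
      δ * γ + γ * - δ                 ≈⟨ +-cong (*-comm δ γ) (sym (-‿distribʳ-* γ δ)) ⟩
      γ * δ - γ * δ                   ≈⟨ -‿inverseʳ (γ * δ) ⟩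
      0#                              ∎
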